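{- Let $\vdash$ be an algebraizable logic with equivalent algebraic semantics the quasivariety $\mathbf{Y}$, and let $f$ be a selector term. The map $\mathsf{QVar}^f$ is a dual isomorphism between the complete lattices $\Lambda^f(\vdash)$ and $\Xi^f(\mathbf{Y})$.
   Context: Let $\mathcal{L}$ be an algebraic language, $\mathsf{Prop}$ a fixed countably infinite set of variables, $Tm(\mathcal{L},\mathsf{Prop})$ the set of terms (formulas). A consequence relation on a set $C$ is a relation between subsets and elements of $C$ that is reflexive ($W\vdash a$ if $a\in W$) and satisfies cut (if $W\vdash v$ for all $v\in V$ and $V\vdash a$ then $W\vdash a$); all consequence relations are assumed finitary (if $W\vdash a$ then $V\vdash a$ for some finite $V\subseteq W$). A logic is a substitution-invariant consequence relation on $Tm(\mathcal{L},\mathsf{Prop})$. $\Lambda(\vdash)$ is the complete lattice of (finitary) logics extending $\vdash$. A quasivariety is a class of algebras closed under isomorphisms, subalgebras and reduced products; $\Xi(\mathbf{Y})$ is the lattice of subquasivarieties of $\mathbf{Y}$. For a class $\mathbf{K}$, $\Theta\vDash_{\mathbf{K}}\gamma\approx\delta$ means that every assignment into an algebra of $\mathbf{K}$ satisfying all equations in $\Theta$ satisfies $\gamma\approx\delta$. The logic $\vdash$ is algebraizable with equivalent algebraic semantics the quasivariety $\mathbf{Y}$ (of language $\mathcal{L}$), witnessed by a finite set $\mu(x)$ of equations in one variable and a finite set $\Delta(x,y)$ of formulas in two variables: (1) $\Gamma\vdash\phi$ iff $\mu[\Gamma]\vDash_{\mathbf{Y}}\mu(\phi)$; (2) $\Theta\vDash_{\mathbf{Y}}\gamma\approx\delta$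 iff $\Delta[\Theta]\vdash\Delta(\gamma,\delta)$; (3) $\phi\dashv\vdash\Delta[\mu(\phi)]$; (4) $\gamma\approx\delta$ and $\mu[\Delta(\gamma,\delta)]$ are $\vDash_{\mathbf{Y}}$-interderivable. Here $\mu[\Gamma]$ is the union of the sets $\mu(\psi)$ for $\psi\in\Gamma$, and $\Delta[\Theta]$ is the union of the sets $\Delta(\varepsilon,\upsilon)$ for $\varepsilon\approx\upsilon$ in $\Theta$. A unary term $f(x)$ of $\mathcal{L}$ is a selector term if it is idempotent, i.e. $f(f(x))\dashv\vdash f(x)$ (each of $f(f(x))$ and $f(x)$ is derivable from the other in $\vdash$). $\chi[f(\overline p)/\overline p]$ is the result of substituting $f(q)$ for each variable $q$ in $\chi$, and $\Gamma[f(\overline p)/\overline p]$ is defined elementwise. For $\vdash_*\in\Lambda(\vdash)$, $\vdash_*^f$ is defined by $\Gamma\vdash_*^f\phi$ iff $\Gamma[f(\overline p)/\overline p]\vdash_*\phi[f(\overline p)/\overline p]$. $\Lambda^f(\vdash)=\{\vdash_*^f:\ \vdash_*\in\Lambda(\vdash)\}$, the $\mathsf{PAt}$-$f$-logics ordered by inclusion (a complete lattice). For $\mathcal{A}\in\mathbf{Y}$, $\mathcal{A}^f=\{a\in A:f(a)=a\}$. For $\mathcal{A},\mathcal{B}\in\mathbf{Y}$, $\mathcal{B}\preceq_f\mathcal{A}$ ($\mathcal{A}$ is a core superalgebra of $\mathcal{B}$) means $\mathcal{B}$ is a subalgebra of $\mathcal{A}$ and $\mathcal{A}^f=\mathcal{B}^f$.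 For $\mathbf{K}\in\Xi(\mathbf{Y})$, $\mathbf{K}^\uparrow=\{\mathcal{A}\in\mathbf{Y}:\exists\mathcal{B}\in\mathbf{K},\ \mathcal{B}\preceq_f\mathcal{A}\}$. $\Xi^f(\mathbf{Y})=\{\mathbf{K}^\uparrow:\mathbf{K}\in\Xi(\mathbf{Y})\}$, the $\mathsf{PAt}$-$f$-quasivarieties ordered by inclusion (a complete lattice). $\mathcal{A}\vDash_f(\Gamma,\phi)$ means: for each $v:\mathsf{Prop}\to\mathcal{A}^f$, if $\mathcal{A},v\vDash\mu[\Gamma]$ then $\mathcal{A},v\vDash\mu(\phi)$. $\mathsf{QVar}^f(\vdash_s)=\{\mathcal{A}\in\mathbf{Y}:\mathcal{A}\vDash_f(\Gamma,\phi)\text{ for all }(\Gamma,\phi)\in{\vdash_s}\}$.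
   Formalization: Besides f(f(x)) ⊣⊢ f(x), the selector term f is assumed idempotent in Y, i.e. Y satisfies f(f(x)) ≈ f(x); with interderivability alone QVar^f can fail to be injective (global modal logic KT, f(x) = □x). -}

module Defs where

open import Level using (Level; 0ℓ; _⊔_) renaming (suc to lsuc)
open import Data.Nat using (ℕ)
open import Data.Fin using (Fin)
open import Data.List as List using (List)
open import Data.List.Membership.Propositional using () renaming (_∈_ to _∈ˡ_)
open import Data.List.Relation.Unary.All using () renaming (All to Allˡ)
open import Data.Product using (Σ; ∃; _×_; _,_; proj₁; proj₂; Σ-syntax; ∃-syntax; uncurry)
open import Data.Vec as Vec using (Vec; []; _∷_)
open import Data.Vec.Relation.Unary.All using (All; []; _∷_)
open import Data.Vec.Relation.Binary.Pointwise.Inductive as Pw using (Pointwise; []; _∷_)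
open import Function using (flip)
open import Function.Bundles using (_⇔_; Bijection)
open import Relation.Binary.Bundles using (Setoid; Poset)
open import Relation.Binary.Core using (REL)
import Relation.Binary.Construct.On as On
open import Relation.Binary.Morphism.Structures using (IsOrderIsomorphism)
open import Relation.Unary using (Pred; _∈_; _⊆_; _≐_; _⊆′_; _≐′_; _∩_; U; ∅; ｛_｝)
open import Relation.Unary.Relation.Binary.Subset using (⊆′-poset)

-- Sets and their subsets live in Set; classes of algebras and consequence
-- relations, whose definitions quantify over all algebras or all sets of
-- formulas, are Set₁-valued predicates.

record Signature : Set₁ where
  field
    Op    : Set
    arity : Op → ℕ

open Signature public

data Term (L : Signature) (X : Set) : Set where
  var : X → Term L X
  app : (o : Op L) → Vec (Term L X) (arity L o) → Term L X

record Equation (L : Signature) (X : Set) : Set where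
  constructor _≈ᵉ_
  field
    lhs rhs : Term L X

infix 5 _≈ᵉ_

-- The propositional variables are the natural numbers.
Form : Signature → Set
Form L = Term L ℕ

Eqn : Signature → Set
Eqn L = Equation L ℕ

private
  variable
    L   : Signature
    X Z : Set

mutual
  _[_] : Term L X → (X → Term L Z) → Term L Z
  var x    [ σ ] = σ x
  app o ts [ σ ] = app o (ts [ σ ]*)

  _[_]* : ∀ {n} → Vec (Term L X) n → (X → Term L Z) → Vec (Term L Z) n
  []       [ σ ]* = []
  (t ∷ ts) [ σ ]* = (t [ σ ]) ∷ (ts [ σ ]*)

_[_]ᵉ : Equation L X → (X → Term L Z) → Equation L Z
(s ≈ᵉ t) [ σ ]ᵉ = (s [ σ ]) ≈ᵉ (t [ σ ])

⟪_⟫ : {C : Set} → List C → Pred C 0ℓ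
⟪ xs ⟫ x = x ∈ˡ xs

ConsequenceOn : Set → Set₂
ConsequenceOn C = REL (Pred C 0ℓ) C (lsuc 0ℓ)

Derives : {C : Set} → ConsequenceOn C → Pred C 0ℓ → Pred C 0ℓ → Set₁
Derives _⊢_ W V = ∀ v → v ∈ V → W ⊢ v

record IsConsequence {C : Set} (_⊢_ : ConsequenceOn C) : Set₁ where
  field
    reflexive : ∀ W a → a ∈ W → W ⊢ a
    cut       : ∀ W V a → Derives _⊢_ W V → V ⊢ a → W ⊢ a
    finitary  : ∀ W a → W ⊢ a → Σ[ V ∈ List C ] Allˡ (_∈ W) V × (⟪ V ⟫ ⊢ a)

Image : {C D : Set} → (C → D) → Pred C 0ℓ → Pred D 0ℓ
Image {C} h W d = Σ[ c ∈ C ] c ∈ W × ｛ h c ｝ d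

Rel⊢ : Signature → Set₂
Rel⊢ L = ConsequenceOn (Form L)

record IsLogic (L : Signature) (_⊢_ : Rel⊢ L) : Set₁ where
  field
    isConsequence : IsConsequence _⊢_
    structural    : ∀ (σ : ℕ → Form L) Γ φ → Γ ⊢ φ → Image (_[ σ ]) Γ ⊢ (φ [ σ ])

-- Algebras. Equality is a setoid equality, so that reduced products exist as
-- algebras; carriers are nonempty.

record Algebra (L : Signature) : Set₁ where
  field
    setoid : Setoid 0ℓ 0ℓ
  open Setoid setoid public
  field
    inhabitant : Carrier
    op         : (o : Op L) → Vec Carrier (arity L o) → Carrier
    op-cong    : ∀ o {xs ys} → Pointwise _≈_ xs ys → op o xs ≈ op o ys

module _ (A : Algebra L) where
  open Algebra A

  mutual
    eval : (X → Carrier) → Term L X → Carrier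
    eval v (var x)    = v x
    eval v (app o ts) = op o (eval* v ts)

    eval* : ∀ {n} → (X → Carrier) → Vec (Term L X) n → Vec Carrier n
    eval* v []       = []
    eval* v (t ∷ ts) = eval v t ∷ eval* v ts

  Holds : (X → Carrier) → Equation L X → Set
  Holds v (s ≈ᵉ t) = eval v s ≈ eval v t

  HoldsAll : (X → Carrier) → Pred (Equation L X) 0ℓ → Set
  HoldsAll v Θ = ∀ e → e ∈ Θ → Holds v e

record _≅_ (A B : Algebra L) : Set where
  private
    module A = Algebra A
    module B = Algebra B
  field
    bijection : Bijection A.setoid B.setoid
  open Bijection bijection using (to)
  field
    homo : ∀ o xs → to (A.op o xs) B.≈ B.op o (Vec.map to xs)

record Subuniverse (A : Algebra L) : Set₁ where
  open Algebra A
  field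
    member    : Pred Carrier 0ℓ
    respects  : ∀ {a b} → a ≈ b → member a → member b
    nonempty  : ∃ member
    op-closed : ∀ o {xs} → All member xs → member (op o xs)

module _ {C : Set} {P : Pred C 0ℓ} where
  all-members : ∀ {n} (xs : Vec (Σ C P) n) → All P (Vec.map proj₁ xs)
  all-members []       = []
  all-members (x ∷ xs) = proj₂ x ∷ all-members xs

_↾_ : (A : Algebra L) → Subuniverse A → Algebra L
A ↾ S = record
  { setoid     = On.setoid setoid (proj₁ {B = member})
  ; inhabitant = nonempty
  ; op         = λ o xs → op o (Vec.map proj₁ xs) , op-closed o (all-members xs)
  ; op-cong    = λ o eqs → op-cong o (Pw.map⁺ (λ eq → eq) eqs)
  }
  where
  open Algebra A
  open Subuniverse S

-- The improper filter is allowed, as is an empty index set, so that the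
-- trivial algebra is a reduced product.
record Filter (I : Set) : Set₁ where
  field
    large        : Pred (Pred I 0ℓ) 0ℓ
    whole        : large U
    upward       : ∀ {V W} → V ⊆ W → large V → large W
    intersection : ∀ {V W} → large V → large W → large (V ∩ W)

module _ {I : Set} (A : I → Algebra L) (F : Filter I) where
  private
    module A i = Algebra (A i)
  open Filter F

  private
    Elt : Set
    Elt = ∀ i → A.Carrier i

    _≈ᶠ_ : Elt → Elt → Set
    g ≈ᶠ h = large (λ i → A._≈_ i (g i) (h i))

    coordinates : ∀ {n} {gs hs : Vec Elt n} → Pointwise _≈ᶠ_ gs hs →
      large (λ i → Pointwise (A._≈_ i) (Vec.map (λ g → g i) gs) (Vec.map (λ h → h i) hs))
    coordinates []         = upward (λ _ → []) whole
    coordinates (eq ∷ eqs) =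
      upward (λ (p , ps) → p ∷ ps) (intersection eq (coordinates eqs))

  ReducedProduct : Algebra L
  ReducedProduct = record
    { setoid = record
      { Carrier       = Elt
      ; _≈_           = _≈ᶠ_
      ; isEquivalence = record
        { refl  = upward (λ {i} _ → A.refl i) whole
        ; sym   = upward (λ {i} → A.sym i)
        ; trans = λ p q → upward (λ {i} (a , b) → A.trans i a b) (intersection p q)
        }
      }
    ; inhabitant = λ i → A.inhabitant i
    ; op         = λ o gs i → A.op i o (Vec.map (λ g → g i) gs)
    ; op-cong    = λ o eqs → upward (λ {i} → A.op-cong i o) (coordinates eqs)
    }

Class : Signature → Set₂
Class L = Pred (Algebra L) (lsuc 0ℓ)

record IsQuasivariety (L : Signature) (K : Class L) : Set₁ where
  field
    iso-closed     : ∀ {A B} → A ≅ B → A ∈ K → B ∈ K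
    sub-closed     : ∀ {A} (S : Subuniverse A) → A ∈ K → (A ↾ S) ∈ K
    reduced-closed : ∀ {I : Set} (A : I → Algebra L) (F : Filter I) →
                     (∀ i → A i ∈ K) → ReducedProduct A F ∈ K

Conseq : (L : Signature) → Class L → ConsequenceOn (Eqn L)
Conseq L K Θ e = ∀ A → A ∈ K → ∀ (v : ℕ → Algebra.Carrier A) → HoldsAll A v Θ → Holds A v e

-- Finite sets μ(x) of equations and Δ(x,y) of formulas.
Eqns₁ : Signature → Set
Eqns₁ L = List (Equation L (Fin 1))

Forms₂ : Signature → Set
Forms₂ L = List (Term L (Fin 2))

_⟨_⟩ : Eqns₁ L → Form L → Pred (Eqn L) 0ℓ
μ ⟨ φ ⟩ = ⟪ List.map (_[ (λ _ → φ) ]ᵉ) μ ⟫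

_[_,_]₂ : Term L (Fin 2) → Form L → Form L → Form L
t [ γ , δ ]₂ = t [ Vec.lookup (γ ∷ δ ∷ []) ]

_⟨_⟩₂ : Forms₂ L → Eqn L → Pred (Form L) 0ℓ
Δ ⟨ γ ≈ᵉ δ ⟩₂ = ⟪ List.map (_[ γ , δ ]₂) Δ ⟫

_⟦_⟧ : Eqns₁ L → Pred (Form L) 0ℓ → Pred (Eqn L) 0ℓ
(μ ⟦ Γ ⟧) e = ∃[ ψ ] ψ ∈ Γ × e ∈ (μ ⟨ ψ ⟩)

_⟦_⟧₂ : Forms₂ L → Pred (Eqn L) 0ℓ → Pred (Form L) 0ℓ
(Δ ⟦ Θ ⟧₂) ψ = ∃[ e ] e ∈ Θ × ψ ∈ (Δ ⟨ e ⟩₂)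

record Algebraizes (L : Signature) (_⊢_ : Rel⊢ L) (Y : Class L)
                   (μ : Eqns₁ L) (Δ : Forms₂ L) : Set₁ where
  private
    _⊨_ : ConsequenceOn (Eqn L)
    _⊨_ = Conseq L Y
  field
    μ-equivalence : ∀ Γ φ → (Γ ⊢ φ) ⇔ Derives _⊨_ (μ ⟦ Γ ⟧) (μ ⟨ φ ⟩)
    Δ-equivalence : ∀ Θ e → (Θ ⊨ e) ⇔ Derives _⊢_ (Δ ⟦ Θ ⟧₂) (Δ ⟨ e ⟩₂)
    Δμ-inverse    : ∀ φ → Derives _⊢_ ｛ φ ｝ (Δ ⟦ μ ⟨ φ ⟩ ⟧₂) × ((Δ ⟦ μ ⟨ φ ⟩ ⟧₂) ⊢ φ)
    μΔ-inverse    : ∀ e → Derives _⊨_ ｛ e ｝ (μ ⟦ Δ ⟨ e ⟩₂ ⟧) × ((μ ⟦ Δ ⟨ e ⟩₂ ⟧) ⊨ e)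

Unary : Signature → Set
Unary L = Term L (Fin 1)

_·_ : Unary L → Form L → Form L
f · φ = f [ (λ _ → φ) ]

IsSelector : (L : Signature) → Rel⊢ L → Unary L → Set₁
IsSelector L _⊢_ f = (｛ f · (f · x) ｝ ⊢ (f · x)) × (｛ f · x ｝ ⊢ (f · (f · x)))
  where
  x : Form L
  x = var 0

-- Idempotence of f as an operation: f(f(x)) ≈ f(x) holds in Y. For a logic
-- algebraized by Y it implies IsSelector, but not conversely, and IsSelector
-- alone does not make QVarᶠ below injective. Let ⊢ be the global modal logic
-- KT and f(x) = □x, so that x, f(x) and f(f(x)) are interderivable. Write Triv
-- for the extension of KT by the axiom x ↔ □x. In a KT-algebra belonging to
-- QVarᶠ (KTBᶠ) the □-fixed elements form a Boolean subalgebra on which □ is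
-- the identity, so the algebra belongs to QVarᶠ (Trivᶠ); but the rule with no
-- premises and conclusion p → □p is in Trivᶠ and not in KTBᶠ, since
-- □p → □□p is not a theorem of KTB.
IdempotentIn : (L : Signature) → Class L → Unary L → Set₁
IdempotentIn L Y f = Conseq L Y ∅ ((f · (f · var 0)) ≈ᵉ (f · var 0))

record IsCompleteLattice {c ℓ₁ ℓ₂} (s : Level) (P : Poset c ℓ₁ ℓ₂) :
                         Set (c ⊔ ℓ₂ ⊔ lsuc s) where
  open Poset P
  field
    infimum  : (S : Pred Carrier s) → Σ[ m ∈ Carrier ]
               (∀ x → x ∈ S → m ≤ x) × (∀ z → (∀ x → x ∈ S → z ≤ x) → z ≤ m)
    supremum : (S : Pred Carrier s) → Σ[ j ∈ Carrier ]
               (∀ x → x ∈ S → x ≤ j) × (∀ z → (∀ x → x ∈ S → x ≤ z) → j ≤ z)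

IsDualIsomorphism : ∀ {c ℓ₁ ℓ₂ d ℓ₃ ℓ₄} (P : Poset c ℓ₁ ℓ₂) (Q : Poset d ℓ₃ ℓ₄) →
                    (Poset.Carrier P → Poset.Carrier Q) → Set (c ⊔ ℓ₁ ⊔ ℓ₂ ⊔ d ⊔ ℓ₃ ⊔ ℓ₄)
IsDualIsomorphism P Q = IsOrderIsomorphism P._≈_ Q._≈_ P._≤_ (flip Q._≤_)
  where
  module P = Poset P
  module Q = Poset Q

-- χ [ f(p̄) / p̄ ]
coreSub : Unary L → Form L → Form L
coreSub f χ = χ [ (λ q → f · var q) ]

-- T ↦ Tᶠ
Variant : Unary L → Rel⊢ L → Rel⊢ L
Variant f _⊢*_ Γ φ = Image (coreSub f) Γ ⊢* coreSub f φ

module _ (L : Signature) (_⊢_ : Rel⊢ L) where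

  IsExtension : Rel⊢ L → Set₁
  IsExtension _⊢*_ = IsLogic L _⊢*_ × (∀ Γ φ → Γ ⊢ φ → Γ ⊢* φ)

  IsFLogic : Unary L → Rel⊢ L → Set₂
  IsFLogic f R = Σ[ T ∈ Rel⊢ L ] IsExtension T × (uncurry R ≐′ uncurry (Variant f T))

  -- Λᶠ(⊢), ordered by inclusion
  FLogics : Unary L → Poset (lsuc (lsuc 0ℓ)) (lsuc 0ℓ) (lsuc 0ℓ)
  FLogics f = On.poset (⊆′-poset (Pred (Form L) 0ℓ × Form L) (lsuc 0ℓ))
                       (λ ((R , _) : Σ (Rel⊢ L) (IsFLogic f)) → uncurry R)

-- 𝒜ᶠ
Core : (A : Algebra L) → Unary L → Pred (Algebra.Carrier A) 0ℓ
Core A f a = eval A (λ _ → a) f ≈ a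
  where open Algebra A

-- (A ↾ S) ⪯f A
CoreSubalgebra : (A : Algebra L) → Unary L → Subuniverse A → Set
CoreSubalgebra A f S = Core A f ≐ λ a → Σ[ a∈S ∈ member a ] (a , a∈S) ∈ Core (A ↾ S) f
  where open Subuniverse S

module _ (L : Signature) (Y : Class L) where

  IsSubquasivariety : Class L → Set₁
  IsSubquasivariety K = IsQuasivariety L K × (K ⊆′ Y)

  Upward : Unary L → Class L → Class L
  Upward f K A = A ∈ Y × (Σ[ S ∈ Subuniverse A ] (A ↾ S) ∈ K × CoreSubalgebra A f S)

  IsFQuasivariety : Unary L → Class L → Set₂
  IsFQuasivariety f V = Σ[ K ∈ Class L ] IsSubquasivariety K × (V ≐′ Upward f K)

  -- Ξᶠ(Y), ordered by inclusion
  FQuasivarieties : Unary L → Poset (lsuc (lsuc 0ℓ)) (lsuc 0ℓ) (lsuc 0ℓ)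
  FQuasivarieties f = On.poset (⊆′-poset (Algebra L) (lsuc 0ℓ))
                               (proj₁ {B = IsFQuasivariety f})

  module _ (μ : Eqns₁ L) (f : Unary L) where

    -- 𝒜 ⊨f (Γ , φ)
    CoreValid : Algebra L → Pred (Form L) 0ℓ → Form L → Set
    CoreValid A Γ φ = ∀ (v : ℕ → Algebra.Carrier A) → (∀ p → v p ∈ Core A f) →
                      HoldsAll A v (μ ⟦ Γ ⟧) → HoldsAll A v (μ ⟨ φ ⟩)

    QVarᶠ : Rel⊢ L → Class L
    QVarᶠ R A = A ∈ Y × (∀ Γ φ → R Γ φ → CoreValid A Γ φ)

{-# OPTIONS --safe #-}
module Submission where

-- For a logic T extending ⊢, let Models T be the quasivariety of the algebras in
-- Y validating T under all assignments. By Maltsev's theorem and the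
-- Lindenbaum–Tarski construction, T is the logic of Models T, and every
-- subquasivariety K of Y is Models of the logic of K. An algebra is in
-- QVarᶠ (Tᶠ) iff the subalgebra generated by its core is in Models T, because the
-- elements of that subalgebra are values of terms at core elements and T is
-- structural; hence QVarᶠ (Tᶠ) = (Models T)↑. Since f is idempotent in Y, an
-- assignment composed with f takes values in the core, so T is recovered on
-- formulas χ[f(p̄)/p̄] and QVarᶠ reflects the order. Completeness of Ξᶠ(Y) comes from
-- intersections of the underlying quasivarieties, and Λᶠ(⊢) inherits it.

open import Defs
open import Axiom.ExcludedMiddle using (ExcludedMiddle)
open import Data.Empty using (⊥-elim)
open import Data.List as List using (List; []; _∷_; _++_)
open import Data.List.Membership.Propositional using () renaming (_∈_ to _∈ˡ_)
open import Data.List.Membership.Propositional.Properties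
  using (∈-map⁺; ∈-map⁻; ∈-concatMap⁺; ∈-++⁺ˡ; ∈-++⁺ʳ)
open import Data.List.Relation.Binary.Subset.Propositional using () renaming (_⊆_ to _⊆ˡ_)
import Data.List.Relation.Unary.All as Allˡ
import Data.List.Relation.Unary.All.Properties as Allˡ
open import Data.List.Relation.Unary.Any as Any using (here; there)
open import Data.Nat using (ℕ; zero; suc)
open import Data.Product using (Σ; ∃; _×_; _,_; proj₁; proj₂; Σ-syntax; uncurry)
open import Data.Unit using (⊤; tt)
open import Data.Vec as Vec using (Vec; []; _∷_)
open import Data.Vec.Relation.Binary.Pointwise.Inductive using (Pointwise; []; _∷_)
open import Data.Vec.Relation.Unary.All as All using (All; []; _∷_)
open import Function using (_∘_; id)
open import Function.Bundles using (Equivalence; Bijection)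
open import Level using (Level; 0ℓ; _⊔_) renaming (suc to lsuc)
open import Relation.Binary.Bundles using (Poset)
open import Relation.Binary.Morphism.Structures using (IsOrderIsomorphism)
open import Relation.Binary.PropositionalEquality as ≡ using (_≡_; refl; cong; cong₂; subst; subst₂)
import Relation.Binary.Reasoning.Setoid as ≈-Reasoning
open import Relation.Nullary using (¬_; Dec; yes; no)
open import Relation.Nullary.Decidable using (True; toWitness; fromWitness; decidable-stable)
open import Relation.Unary using (Pred; _∈_; _⊆_; _⊆′_; _≐′_; ｛_｝)

private
  variable
    L     : Signature
    W X Z : Set

-- Terms and evaluation

mutual
  []-∘ : (σ : X → Term L Z) (τ : Z → Term L W) (t : Term L X) →
         t [ σ ] [ τ ] ≡ t [ (λ x → σ x [ τ ]) ]
  []-∘ σ τ (var x)    = refl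
  []-∘ σ τ (app o ts) = cong (app o) ([]*-∘ σ τ ts)

  []*-∘ : ∀ {n} (σ : X → Term L Z) (τ : Z → Term L W) (ts : Vec (Term L X) n) →
          ts [ σ ]* [ τ ]* ≡ ts [ (λ x → σ x [ τ ]) ]*
  []*-∘ σ τ []       = refl
  []*-∘ σ τ (t ∷ ts) = cong₂ _∷_ ([]-∘ σ τ t) ([]*-∘ σ τ ts)

mutual
  []-var : (t : Term L X) → t [ var ] ≡ t
  []-var (var x)    = refl
  []-var (app o ts) = cong (app o) ([]*-var ts)

  []*-var : ∀ {n} (ts : Vec (Term L X) n) → ts [ var ]* ≡ ts
  []*-var []       = refl
  []*-var (t ∷ ts) = cong₂ _∷_ ([]-var t) ([]*-var ts)

mutual
  vars : Term L X → List X
  vars (var x)    = x ∷ []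
  vars (app o ts) = vars* ts

  vars* : ∀ {n} → Vec (Term L X) n → List X
  vars* []       = []
  vars* (t ∷ ts) = vars t ++ vars* ts

module _ (A : Algebra L) where
  open Algebra A using (Carrier; _≈_; op; op-cong)

  mutual
    eval-[] : (v : Z → Carrier) (σ : X → Term L Z) (t : Term L X) →
              eval A v (t [ σ ]) ≡ eval A (λ x → eval A v (σ x)) t
    eval-[] v σ (var x)    = refl
    eval-[] v σ (app o ts) = cong (op o) (eval*-[] v σ ts)

    eval*-[] : ∀ {n} (v : Z → Carrier) (σ : X → Term L Z) (ts : Vec (Term L X) n) →
               eval* A v (ts [ σ ]*) ≡ eval* A (λ x → eval A v (σ x)) ts
    eval*-[] v σ []       = refl
    eval*-[] v σ (t ∷ ts) = cong₂ _∷_ (eval-[] v σ t) (eval*-[] v σ ts)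

  mutual
    eval-cong : {v w : X → Carrier} → (∀ x → v x ≈ w x) → ∀ t → eval A v t ≈ eval A w t
    eval-cong v≈w (var x)    = v≈w x
    eval-cong v≈w (app o ts) = op-cong o (eval*-cong v≈w ts)

    eval*-cong : ∀ {n} {v w : X → Carrier} → (∀ x → v x ≈ w x) →
                 (ts : Vec (Term L X) n) → Pointwise _≈_ (eval* A v ts) (eval* A w ts)
    eval*-cong v≈w []       = []
    eval*-cong v≈w (t ∷ ts) = eval-cong v≈w t ∷ eval*-cong v≈w ts

  mutual
    -- A renaming into `ℕ` can be undone only at finitely many variables, so `finite-renaming` needs
    -- values to depend on the occurring variables alone.
    eval-local : {v w : X → Carrier} (t : Term L X) →
                 (∀ {x} → x ∈ˡ vars t → v x ≡ w x) → eval A v t ≡ eval A w t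
    eval-local (var x)    v≡w = v≡w (here refl)
    eval-local (app o ts) v≡w = cong (op o) (eval*-local ts v≡w)

    eval*-local : ∀ {n} {v w : X → Carrier} (ts : Vec (Term L X) n) →
                  (∀ {x} → x ∈ˡ vars* ts → v x ≡ w x) → eval* A v ts ≡ eval* A w ts
    eval*-local []       v≡w = refl
    eval*-local (t ∷ ts) v≡w =
      cong₂ _∷_ (eval-local t (v≡w ∘ ∈-++⁺ˡ)) (eval*-local ts (v≡w ∘ ∈-++⁺ʳ (vars t)))

  eval*-vars : ∀ {n} (xs : Vec Carrier n) → eval* A id (Vec.map var xs) ≡ xs
  eval*-vars []       = refl
  eval*-vars (x ∷ xs) = cong (x ∷_) (eval*-vars xs)

-- Embeddings

-- Stands for an isomorphism onto a subalgebra. Equations transfer both ways along such a map, so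
-- closure under isomorphisms and under subalgebras can be treated alike.
record Embedding (A B : Algebra L) : Set where
  private
    module A = Algebra A
    module B = Algebra B
  field
    to        : A.Carrier → B.Carrier
    to-cong   : ∀ {a b} → a A.≈ b → to a B.≈ to b
    injective : ∀ {a b} → to a B.≈ to b → a A.≈ b
    homo      : ∀ o xs → to (A.op o xs) B.≈ B.op o (Vec.map to xs)

  mutual
    to-eval : (v : X → A.Carrier) (t : Term L X) → to (eval A v t) B.≈ eval B (to ∘ v) t
    to-eval v (var x)    = B.refl
    to-eval v (app o ts) = B.trans (homo o _) (B.op-cong o (to-eval* v ts))

    to-eval* : ∀ {n} (v : X → A.Carrier) (ts : Vec (Term L X) n) →
               Pointwise B._≈_ (Vec.map to (eval* A v ts)) (eval* B (to ∘ v) ts)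
    to-eval* v []       = []
    to-eval* v (t ∷ ts) = to-eval v t ∷ to-eval* v ts

  preserves : (v : X → A.Carrier) (e : Equation L X) → Holds A v e → Holds B (to ∘ v) e
  preserves v (s ≈ᵉ t) s≈t =
    B.trans (B.sym (to-eval v s)) (B.trans (to-cong s≈t) (to-eval v t))

  reflects : (v : X → A.Carrier) (e : Equation L X) → Holds B (to ∘ v) e → Holds A v e
  reflects v (s ≈ᵉ t) s≈t =
    injective (B.trans (to-eval v s) (B.trans s≈t (B.sym (to-eval v t))))

inclusion : (A : Algebra L) (S : Subuniverse A) → Embedding (A ↾ S) A
inclusion A S = record
  { to = proj₁ ; to-cong = id ; injective = id ; homo = λ _ _ → Algebra.refl A }

subuniverse-⊆⇒embedding : (A : Algebra L) (S T : Subuniverse A) →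
  Subuniverse.member S ⊆ Subuniverse.member T → Embedding (A ↾ S) (A ↾ T)
subuniverse-⊆⇒embedding A S T S⊆T = record
  { to        = λ (a , a∈S) → a , S⊆T a∈S
  ; to-cong   = id
  ; injective = id
  ; homo      = λ o xs → op-cong o (same-points xs)
  }
  where
  open Algebra A using (Carrier; _≈_; op-cong)
  same-points : ∀ {n} (xs : Vec (Σ Carrier (Subuniverse.member S)) n) →
    Pointwise _≈_ (Vec.map proj₁ xs) (Vec.map proj₁ (Vec.map (λ (a , a∈S) → a , S⊆T a∈S) xs))
  same-points []       = []
  same-points (x ∷ xs) = Algebra.refl A ∷ same-points xs

-- The direction is reversed because validity passes from the target of an embedding to its source.
≅⇒embedding⁻¹ : {A B : Algebra L} → A ≅ B → Embedding B A
≅⇒embedding⁻¹ {A = A} {B} iso = record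
  { to        = from
  ; to-cong   = λ {a} {b} a≈b → to-inj (B.trans (to-from a) (B.trans a≈b (B.sym (to-from b))))
  ; injective = λ {a} {b} eq → B.trans (B.sym (to-from a)) (B.trans (to-cong eq) (to-from b))
  ; homo      = λ o ys → to-inj (B.trans (to-from _)
                  (B.trans (B.op-cong o (to-from* ys)) (B.sym (homo o _))))
  }
  where
  module A = Algebra A
  module B = Algebra B
  open _≅_ iso
  open Bijection bijection using (to; surjective) renaming (cong to to-cong; injective to to-inj)
  from : B.Carrier → A.Carrier
  from b = proj₁ (surjective b)
  to-from : ∀ b → to (from b) B.≈ b
  to-from b = proj₂ (surjective b) A.refl
  to-from* : ∀ {n} (ys : Vec B.Carrier n) →
             Pointwise B._≈_ ys (Vec.map to (Vec.map from ys))
  to-from* []       = []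
  to-from* (y ∷ ys) = B.sym (to-from y) ∷ to-from* ys

module _ {K : Class L} (K-quasi : IsQuasivariety L K) where
  open IsQuasivariety K-quasi

  -- The image is a subuniverse of `B` whose members carry a preimage; returning that preimage is an
  -- isomorphism onto `A`.
  embedding-closed : {A B : Algebra L} → Embedding A B → B ∈ K → A ∈ K
  embedding-closed {A} {B} h B∈K = iso-closed image≅A (sub-closed image B∈K)
    where
    module A = Algebra A
    module B = Algebra B
    open Embedding h

    image : Subuniverse B
    image = record
      { member    = λ b → Σ[ a ∈ A.Carrier ] to a B.≈ b
      ; respects  = λ b≈c (a , ha≈b) → a , B.trans ha≈b b≈c
      ; nonempty  = to A.inhabitant , A.inhabitant , B.refl
      ; op-closed = λ o ms → A.op o (All.reduce proj₁ ms) ,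
                             B.trans (homo o _) (B.op-cong o (images ms))
      }
      where
      images : ∀ {n} {bs : Vec B.Carrier n} (ms : All (λ b → Σ[ a ∈ A.Carrier ] to a B.≈ b) bs) →
               Pointwise B._≈_ (Vec.map to (All.reduce proj₁ ms)) bs
      images []             = []
      images ((_ , eq) ∷ ms) = eq ∷ images ms

    Elt : Set
    Elt = Algebra.Carrier (B ↾ image)

    preimage : Elt → A.Carrier
    preimage (_ , a , _) = a

    preimages : ∀ {n} (xs : Vec Elt n) →
                All.reduce proj₁ (all-members xs) ≡ Vec.map preimage xs
    preimages []       = refl
    preimages (x ∷ xs) = cong (_ ∷_) (preimages xs)

    image≅A : (B ↾ image) ≅ A
    image≅A = record
      { bijection = record
        { to        = preimage
        ; cong      = λ { {_ , _ , p} {_ , _ , q} eq →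
                          injective (B.trans p (B.trans eq (B.sym q))) }
        ; bijective = (λ { {_ , _ , p} {_ , _ , q} eq →
                           B.trans (B.sym p) (B.trans (to-cong eq) q) })
                    , λ a → (to a , a , B.refl) ,
                            λ { {_ , _ , p} eq → injective (B.trans p eq) }
        }
      ; homo = λ o xs → A.reflexive (cong (A.op o) (preimages xs))
      }

-- Reduced products

module _ {I : Set} (F : Filter I) where
  open Filter F

  large-∀∈ : (Q : Z → Pred I 0ℓ) (zs : List Z) → (∀ z → z ∈ˡ zs → large (Q z)) →
             large (λ i → ∀ z → z ∈ˡ zs → Q z i)
  large-∀∈ Q []       _  = upward (λ _ _ ()) whole
  large-∀∈ Q (z ∷ zs) lQ =
    upward (λ { (q , qs) _ (here refl) → q ; (q , qs) y (there y∈zs) → qs y y∈zs })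
      (intersection (lQ z (here refl)) (large-∀∈ Q zs (λ y → lQ y ∘ there)))

  module _ (A : I → Algebra L) (v : X → ∀ i → Algebra.Carrier (A i)) where
    private
      P : Algebra L
      P = ReducedProduct A F

    mutual
      eval-coordinate : ∀ i t → eval P v t i ≡ eval (A i) (λ x → v x i) t
      eval-coordinate i (var x)    = refl
      eval-coordinate i (app o ts) = cong (Algebra.op (A i) o) (eval*-coordinate i ts)

      eval*-coordinate : ∀ {n} i (ts : Vec (Term L X) n) →
        Vec.map (λ g → g i) (eval* P v ts) ≡ eval* (A i) (λ x → v x i) ts
      eval*-coordinate i []       = refl
      eval*-coordinate i (t ∷ ts) = cong₂ _∷_ (eval-coordinate i t) (eval*-coordinate i ts)

    -- The equational case of Łoś's theorem, true for every filter because equality in the product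
    -- is largeness of the set of agreeing coordinates.
    ReducedProduct-Holds⁺ : ∀ e → large (λ i → Holds (A i) (λ x → v x i) e) → Holds P v e
    ReducedProduct-Holds⁺ (s ≈ᵉ t) = upward (λ {i} →
      subst₂ (Algebra._≈_ (A i)) (≡.sym (eval-coordinate i s)) (≡.sym (eval-coordinate i t)))

    ReducedProduct-Holds⁻ : ∀ e → Holds P v e → large (λ i → Holds (A i) (λ x → v x i) e)
    ReducedProduct-Holds⁻ (s ≈ᵉ t) = upward (λ {i} →
      subst₂ (Algebra._≈_ (A i)) (eval-coordinate i s) (eval-coordinate i t))

    ReducedProduct-HoldsAll⁺ : ∀ es → large (λ i → HoldsAll (A i) (λ x → v x i) ⟪ es ⟫) →
                               HoldsAll P v ⟪ es ⟫
    ReducedProduct-HoldsAll⁺ es l e e∈es = ReducedProduct-Holds⁺ e (upward (λ h → h e e∈es) l)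

    ReducedProduct-HoldsAll⁻ : ∀ es → HoldsAll P v ⟪ es ⟫ →
                               large (λ i → HoldsAll (A i) (λ x → v x i) ⟪ es ⟫)
    ReducedProduct-HoldsAll⁻ es h =
      large-∀∈ (λ e i → Holds (A i) (λ x → v x i) e) es
        (λ e e∈es → ReducedProduct-Holds⁻ e (h e e∈es))

-- The supersets of finite sets of constraints form a filter base, and modulo
-- that filter every constraint holds. The second component of an index, over
-- which the filter is trivial, serves to refute all bad i in one product.
simultaneous-model : (K : Class L) → IsQuasivariety L K → {E : Set}
  (constraint : Z → List (Equation L X)) (bad : E → List (Equation L X)) →
  (∀ (zs : List Z) (i : E) → Σ[ A ∈ Algebra L ] A ∈ K × Σ[ v ∈ (X → Algebra.Carrier A) ]
     (∀ z → z ∈ˡ zs → HoldsAll A v ⟪ constraint z ⟫) × ¬ HoldsAll A v ⟪ bad i ⟫) →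
  Σ[ A ∈ Algebra L ] A ∈ K × Σ[ v ∈ (X → Algebra.Carrier A) ]
    (∀ z → HoldsAll A v ⟪ constraint z ⟫) × (∀ i → ¬ HoldsAll A v ⟪ bad i ⟫)
simultaneous-model {L} {Z} {X} K K-quasi {E} constraint bad model =
  ReducedProduct A F , IsQuasivariety.reduced-closed K-quasi A F A∈K , v , good , refuted
  where
  I : Set
  I = List Z × E

  F : Filter I
  F = record
    { large        = λ V → Σ[ zs ∈ List Z ] ∀ ys → zs ⊆ˡ ys → ∀ i → V (ys , i)
    ; whole        = [] , λ _ _ _ → tt
    ; upward       = λ V⊆W (zs , h) → zs , λ ys zs⊆ys i → V⊆W (h ys zs⊆ys i)
    ; intersection = λ (zs , h) (zs′ , h′) → zs ++ zs′ , λ ys ⊆ys i →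
                       h ys (⊆ys ∘ ∈-++⁺ˡ) i , h′ ys (⊆ys ∘ ∈-++⁺ʳ zs) i
    }

  A : I → Algebra L
  A (zs , i) = proj₁ (model zs i)

  A∈K : ∀ i → A i ∈ K
  A∈K (zs , i) = proj₁ (proj₂ (model zs i))

  v : X → ∀ i → Algebra.Carrier (A i)
  v x (zs , i) = proj₁ (proj₂ (proj₂ (model zs i))) x

  good : ∀ z → HoldsAll (ReducedProduct A F) v ⟪ constraint z ⟫
  good z = ReducedProduct-HoldsAll⁺ F A v (constraint z)
    (z ∷ [] , λ ys z⊆ys i → proj₁ (proj₂ (proj₂ (proj₂ (model ys i)))) z (z⊆ys (here refl)))

  refuted : ∀ i → ¬ HoldsAll (ReducedProduct A F) v ⟪ bad i ⟫
  -- The large set contains the index formed by `zs` itself and `i`, and the algebra at that index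
  -- was chosen to refute `bad i`.
  refuted i h with ReducedProduct-HoldsAll⁻ F A v (bad i) h
  ... | zs , all = proj₂ (proj₂ (proj₂ (proj₂ (model zs i)))) (all zs id i)

-- Equations under substitution, and finite lists as assignments

Holds-[]⁺ : (A : Algebra L) (v : Z → Algebra.Carrier A) (σ : X → Term L Z) (e : Equation L X) →
            Holds A (λ x → eval A v (σ x)) e → Holds A v (e [ σ ]ᵉ)
Holds-[]⁺ A v σ (s ≈ᵉ t) =
  subst₂ (Algebra._≈_ A) (≡.sym (eval-[] A v σ s)) (≡.sym (eval-[] A v σ t))

Holds-[]⁻ : (A : Algebra L) (v : Z → Algebra.Carrier A) (σ : X → Term L Z) (e : Equation L X) →
            Holds A v (e [ σ ]ᵉ) → Holds A (λ x → eval A v (σ x)) e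
Holds-[]⁻ A v σ (s ≈ᵉ t) = subst₂ (Algebra._≈_ A) (eval-[] A v σ s) (eval-[] A v σ t)

Holds-cong : (A : Algebra L) {v w : X → Algebra.Carrier A} → (∀ x → Algebra._≈_ A (v x) (w x)) →
             ∀ e → Holds A v e → Holds A w e
Holds-cong A v≈w (s ≈ᵉ t) eq =
  A.trans (A.sym (eval-cong A v≈w s)) (A.trans eq (eval-cong A v≈w t))
  where module A = Algebra A

nth : X → List X → ℕ → X
nth x₀ []       n       = x₀
nth x₀ (x ∷ xs) zero    = x
nth x₀ (x ∷ xs) (suc n) = nth x₀ xs n

position : (x₀ : X) {x : X} {xs : List X} → x ∈ˡ xs → Σ[ n ∈ ℕ ] nth x₀ xs n ≡ x
position x₀ (here refl) = zero , refl
position x₀ (there x∈xs) with position x₀ x∈xs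
... | n , eq = suc n , eq

-- Truth of formulas in algebras

module _ (μ : Eqns₁ L) where

  -- The truth set that `μ` defines in an algebra. Truth of an element, rather than of a formula,
  -- keeps the substitutions in `μ ⟨ φ ⟩` out of later arguments.
  Designated : (A : Algebra L) → Pred (Algebra.Carrier A) 0ℓ
  Designated A a = HoldsAll A (λ _ → a) ⟪ μ ⟫

  AllDesignated : (A : Algebra L) → (ℕ → Algebra.Carrier A) → Pred (Form L) 0ℓ → Set
  AllDesignated A v Γ = ∀ ψ → ψ ∈ Γ → Designated A (eval A v ψ)

  Valid : Algebra L → Pred (Form L) 0ℓ → Form L → Set
  Valid A Γ φ = ∀ v → AllDesignated A v Γ → Designated A (eval A v φ)

  LogicOf : Class L → Rel⊢ L
  LogicOf K Γ φ = ∀ A → A ∈ K → Valid A Γ φ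

  Models : Class L → Rel⊢ L → Class L
  Models Y T A = A ∈ Y × (∀ Γ φ → T Γ φ → Valid A Γ φ)

  Designated-resp : (A : Algebra L) → ∀ {a b} → Algebra._≈_ A a b →
                    Designated A a → Designated A b
  Designated-resp A a≈b h m m∈μ = Holds-cong A (λ _ → a≈b) m (h m m∈μ)

  Designated-[]⁺ : (A : Algebra L) (v : X → Algebra.Carrier A) (σ : ℕ → Term L X) (φ : Form L) →
                   Designated A (eval A (λ p → eval A v (σ p)) φ) → Designated A (eval A v (φ [ σ ]))
  Designated-[]⁺ A v σ φ = subst (Designated A) (≡.sym (eval-[] A v σ φ))

  Designated-[]⁻ : (A : Algebra L) (v : X → Algebra.Carrier A) (σ : ℕ → Term L X) (φ : Form L) →
                   Designated A (eval A v (φ [ σ ])) → Designated A (eval A (λ p → eval A v (σ p)) φ)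
  Designated-[]⁻ A v σ φ = subst (Designated A) (eval-[] A v σ φ)

  Designated⇒μ : (A : Algebra L) (v : ℕ → Algebra.Carrier A) (φ : Form L) →
                 Designated A (eval A v φ) → HoldsAll A v (μ ⟨ φ ⟩)
  Designated⇒μ A v φ h e e∈ with ∈-map⁻ _ e∈
  ... | m , m∈μ , refl = Holds-[]⁺ A v (λ _ → φ) m (h m m∈μ)

  μ⇒Designated : (A : Algebra L) (v : ℕ → Algebra.Carrier A) (φ : Form L) →
                 HoldsAll A v (μ ⟨ φ ⟩) → Designated A (eval A v φ)
  μ⇒Designated A v φ h m m∈μ = Holds-[]⁻ A v (λ _ → φ) m (h _ (∈-map⁺ _ m∈μ))

  AllDesignated⇒μ : (A : Algebra L) (v : ℕ → Algebra.Carrier A) (Γ : Pred (Form L) 0ℓ) →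
                    AllDesignated A v Γ → HoldsAll A v (μ ⟦ Γ ⟧)
  AllDesignated⇒μ A v Γ h e (ψ , ψ∈Γ , e∈) = Designated⇒μ A v ψ (h ψ ψ∈Γ) e e∈

  μ⇒AllDesignated : (A : Algebra L) (v : ℕ → Algebra.Carrier A) (Γ : Pred (Form L) 0ℓ) →
                    HoldsAll A v (μ ⟦ Γ ⟧) → AllDesignated A v Γ
  μ⇒AllDesignated A v Γ h ψ ψ∈Γ = μ⇒Designated A v ψ (λ e e∈ → h e (ψ , ψ∈Γ , e∈))

  module _ {A B : Algebra L} (h : Embedding A B) where
    open Embedding h

    Designated-to⁺ : ∀ {a} → Designated A a → Designated B (to a)
    Designated-to⁺ d m m∈μ = preserves _ m (d m m∈μ)

    Designated-to⁻ : ∀ {a} → Designated B (to a) → Designated A a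
    Designated-to⁻ d m m∈μ = reflects _ m (d m m∈μ)

    Valid-embedding : ∀ Γ φ → Valid B Γ φ → Valid A Γ φ
    Valid-embedding Γ φ valid v prem =
      Designated-to⁻ (Designated-resp B (Algebra.sym B (to-eval v φ))
        (valid (to ∘ v) λ ψ ψ∈Γ →
          Designated-resp B (to-eval v ψ) (Designated-to⁺ (prem ψ ψ∈Γ))))

  -- Being finitely many, the premises hold jointly on a large set of coordinates, and on that set
  -- the conclusion holds too.
  Valid-ReducedProduct : {I : Set} (A : I → Algebra L) (F : Filter I) (V : List (Form L)) (φ : Form L) →
    (∀ i → Valid (A i) ⟪ V ⟫ φ) → Valid (ReducedProduct A F) ⟪ V ⟫ φ
  Valid-ReducedProduct {I} A F V φ valid v prem =
    ReducedProduct-HoldsAll⁺ F A (λ _ → eval P v φ) μ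
      (upward (λ {i} → subst (Designated (A i)) (≡.sym (eval-coordinate F A v i φ)) ∘ valid i (at i))
        (large-∀∈ F (λ ψ i → Designated (A i) (eval (A i) (at i) ψ)) V λ ψ ψ∈V →
          upward (λ {i} → subst (Designated (A i)) (eval-coordinate F A v i ψ))
            (ReducedProduct-HoldsAll⁻ F A (λ _ → eval P v ψ) μ (prem ψ ψ∈V))))
    where
    open Filter F
    P : Algebra L
    P = ReducedProduct A F
    at : ∀ i → ℕ → Algebra.Carrier (A i)
    at i p = v p i

  Models-isQuasivariety : {Y : Class L} {T : Rel⊢ L} → IsQuasivariety L Y → IsConsequence T →
                          IsQuasivariety L (Models Y T)
  Models-isQuasivariety Y-quasi T-cons = record
    { iso-closed     = λ A≅B (A∈Y , valid) →
        Y.iso-closed A≅B A∈Y , λ Γ φ r → Valid-embedding (≅⇒embedding⁻¹ A≅B) Γ φ (valid Γ φ r)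
    ; sub-closed     = λ {A} S (A∈Y , valid) →
        Y.sub-closed S A∈Y , λ Γ φ r → Valid-embedding (inclusion A S) Γ φ (valid Γ φ r)
    ; reduced-closed = λ A F A∈ → Y.reduced-closed A F (proj₁ ∘ A∈) , λ Γ φ r v prem →
        -- `Valid-ReducedProduct` concerns finite lists of premises; finitarity of `T` provides one
        -- inside `Γ`.
        let V , V⊆Γ , r′ = finitary Γ φ r in
        Valid-ReducedProduct A F V φ (λ i → proj₂ (A∈ i) ⟪ V ⟫ φ r′) v
          (λ ψ ψ∈V → prem ψ (Allˡ.lookup V⊆Γ ψ∈V))
    }
    where
    module Y = IsQuasivariety Y-quasi
    open IsConsequence T-cons

-- Quotients of the term algebra

module _ {Y : Class L} (D : Pred (Eqn L) 0ℓ) (closed : ∀ e → Conseq L Y D e → e ∈ D) where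

  -- A set of equations closed under consequence over `Y` is a congruence of the term algebra,
  -- because the laws of equality hold in every algebra.
  TermModel : Algebra L
  TermModel = record
    { setoid     = record
      { Carrier       = Form L
      ; _≈_           = λ s t → D (s ≈ᵉ t)
      ; isEquivalence = record
        { refl  = closed _ (λ A _ v _ → Algebra.refl A)
        ; sym   = λ p → closed _ (λ A _ v h → Algebra.sym A (h _ p))
        ; trans = λ p q → closed _ (λ A _ v h → Algebra.trans A (h _ p) (h _ q))
        }
      }
    ; inhabitant = var 0
    ; op         = app
    ; op-cong    = λ o ps → closed _ (λ A _ v h → Algebra.op-cong A o (evaluate A v h ps))
    }
    where
    evaluate : ∀ A v → HoldsAll A v D → ∀ {n} {ss ts : Vec (Form L) n} →
               Pointwise (λ s t → D (s ≈ᵉ t)) ss ts →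
               Pointwise (Algebra._≈_ A) (eval* A v ss) (eval* A v ts)
    evaluate A v h []       = []
    evaluate A v h (p ∷ ps) = h _ p ∷ evaluate A v h ps

  mutual
    eval-TermModel : (σ : X → Form L) (t : Term L X) → eval TermModel σ t ≡ t [ σ ]
    eval-TermModel σ (var x)    = refl
    eval-TermModel σ (app o ts) = cong (app o) (eval*-TermModel σ ts)

    eval*-TermModel : ∀ {n} (σ : X → Form L) (ts : Vec (Term L X) n) →
                      eval* TermModel σ ts ≡ ts [ σ ]*
    eval*-TermModel σ []       = refl
    eval*-TermModel σ (t ∷ ts) = cong₂ _∷_ (eval-TermModel σ t) (eval*-TermModel σ ts)

  TermModel-Holds⁺ : (σ : X → Form L) (e : Equation L X) → e [ σ ]ᵉ ∈ D → Holds TermModel σ e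
  TermModel-Holds⁺ σ (s ≈ᵉ t) =
    subst₂ (λ a b → D (a ≈ᵉ b)) (≡.sym (eval-TermModel σ s)) (≡.sym (eval-TermModel σ t))

  TermModel-Holds⁻ : (σ : X → Form L) (e : Equation L X) → Holds TermModel σ e → e [ σ ]ᵉ ∈ D
  TermModel-Holds⁻ σ (s ≈ᵉ t) =
    subst₂ (λ a b → D (a ≈ᵉ b)) (eval-TermModel σ s) (eval-TermModel σ t)

-- The core of an algebra

module _ (f : Unary L) where

  module _ (A : Algebra L) where
    open Algebra A using (Carrier; _≈_; op; op-cong)
    private
      module A = Algebra A

    -- `f` is computed in a subalgebra as in `A`, so the two cores could differ only by core
    -- elements missing from `S`.
    Core⊆⇒CoreSubalgebra : (S : Subuniverse A) → Core A f ⊆ Subuniverse.member S →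
                           CoreSubalgebra A f S
    Core⊆⇒CoreSubalgebra S core⊆S =
      (λ {a} fa≈a → core⊆S fa≈a , A.trans (to-eval (λ _ → a , core⊆S fa≈a) f) fa≈a) ,
      (λ {a} (a∈S , fa≈a) → A.trans (A.sym (to-eval (λ _ → a , a∈S) f)) fa≈a)
      where open Embedding (inclusion A S)

    module _ (c₀ : ∃ (Core A f)) where

      -- Membership carries a term whose variables are core elements; these terms later become a
      -- substitution. The element `c₀` secures nonemptiness.
      coreGenerated : Subuniverse A
      coreGenerated = record
        { member    = λ a → Σ[ t ∈ Term L (∃ (Core A f)) ] eval A proj₁ t ≈ a
        ; respects  = λ a≈b (t , eq) → t , A.trans eq a≈b
        ; nonempty  = proj₁ c₀ , var c₀ , A.refl
        ; op-closed = λ o ms → app o (All.reduce proj₁ ms) , op-cong o (values ms)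
        }
        where
        values : ∀ {n} {as : Vec Carrier n}
          (ms : All (λ a → Σ[ t ∈ Term L (∃ (Core A f)) ] eval A proj₁ t ≈ a) as) →
          Pointwise _≈_ (eval* A proj₁ (All.reduce proj₁ ms)) as
        values []              = []
        values ((_ , eq) ∷ ms) = eq ∷ values ms

      core⊆coreGenerated : Core A f ⊆ Subuniverse.member coreGenerated
      core⊆coreGenerated fa≈a = var (_ , fa≈a) , A.refl

      coreGenerated-least : (S : Subuniverse A) → Core A f ⊆ Subuniverse.member S →
                            Subuniverse.member coreGenerated ⊆ Subuniverse.member S
      coreGenerated-least S core⊆S (t , eq) =
        Subuniverse.respects S (A.trans (Embedding.to-eval (inclusion A S) v t) eq)
          (proj₂ (eval (A ↾ S) v t))
        where
        v : ∃ (Core A f) → Algebra.Carrier (A ↾ S)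
        v (a , fa≈a) = a , core⊆S fa≈a

    -- Since `f` fixes core elements, f(q) and q have the same value for each variable q.
    coreSub-eval : {v : ℕ → Carrier} → (∀ p → v p ∈ Core A f) → ∀ χ →
                   eval A v (coreSub f χ) ≈ eval A v χ
    coreSub-eval {v} v∈core χ = A.trans (A.reflexive (eval-[] A v (λ q → f · var q) χ))
      (eval-cong A (λ q → A.trans (A.reflexive (eval-[] A v (λ _ → var q) f)) (v∈core q)) χ)

  Upward-mono : (Y K K′ : Class L) → K ⊆′ K′ → Upward L Y f K ⊆′ Upward L Y f K′
  Upward-mono Y K K′ K⊆K′ A (A∈Y , S , S∈K , same-core) = A∈Y , S , K⊆K′ _ S∈K , same-core

  module _ {Y : Class L} (idem : IdempotentIn L Y f) {A : Algebra L} (A∈Y : A ∈ Y) where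
    private
      module A = Algebra A

    -- Idempotence in `Y` enters here. Both the existence of core elements and the passage from
    -- arbitrary to core assignments rest on it.
    f-value∈Core : ∀ a → eval A (λ _ → a) f ∈ Core A f
    f-value∈Core a = subst₂ A._≈_
      (≡.trans (eval-[] A v (λ _ → f · var 0) f) (cong (λ b → eval A (λ _ → b) f) f-value))
      f-value (idem A A∈Y v (λ _ ()))
      where
      v : ℕ → A.Carrier
      v _ = a
      f-value : eval A v (f · var 0) ≡ eval A (λ _ → a) f
      f-value = eval-[] A v (λ _ → var 0) f

    core-inhabited : ∃ (Core A f)
    core-inhabited = _ , f-value∈Core A.inhabitant

    f·var∈Core : (v : ℕ → A.Carrier) → ∀ q → eval A v (f · var q) ∈ Core A f
    f·var∈Core v q =
      subst (Core A f) (≡.sym (eval-[] A v (λ _ → var q) f)) (f-value∈Core (v q))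

  module _ (Y : Class L) (μ : Eqns₁ L) where

    QVarᶠ-antitone : {R R′ : Rel⊢ L} → uncurry R ⊆′ uncurry R′ →
                     QVarᶠ L Y μ f R′ ⊆′ QVarᶠ L Y μ f R
    QVarᶠ-antitone R⊆R′ A (A∈Y , valid) = A∈Y , λ Γ φ r → valid Γ φ (R⊆R′ (Γ , φ) r)

    -- Under a core assignment `coreSub` changes no value, so a rule of the variant is true there
    -- because its substituted form is a rule of `T`.
    Models⊆QVarᶠ : (T : Rel⊢ L) → Models μ Y T ⊆′ QVarᶠ L Y μ f (Variant f T)
    Models⊆QVarᶠ T A (A∈Y , valid) = A∈Y , λ Γ φ r v v∈core prem →
      Designated⇒μ μ A v φ (Designated-resp μ A (coreSub-eval A v∈core φ)
        (valid _ _ r v λ { _ (ψ , ψ∈Γ , refl) →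
          Designated-resp μ A (Algebra.sym A (coreSub-eval A v∈core ψ))
            (μ⇒AllDesignated μ A v Γ prem ψ ψ∈Γ) }))

    -- Core assignments into `A` already take values in the subalgebra, where equations have the
    -- same truth.
    CoreValid-superalgebra : (A : Algebra L) (S : Subuniverse A) → CoreSubalgebra A f S →
      ∀ Γ φ → CoreValid L Y μ f (A ↾ S) Γ φ → CoreValid L Y μ f A Γ φ
    CoreValid-superalgebra A S (core⊆S , _) Γ φ valid v v∈core prem e e∈ =
      preserves w e (valid w (λ p → proj₂ (core⊆S (v∈core p)))
        (λ e′ e′∈ → reflects w e′ (prem e′ e′∈)) e e∈)
      where
      open Embedding (inclusion A S)
      w : ℕ → Algebra.Carrier (A ↾ S)
      w p = v p , proj₁ (core⊆S (v∈core p))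

    Upward-Models⊆QVarᶠ : (T : Rel⊢ L) → Upward L Y f (Models μ Y T) ⊆′ QVarᶠ L Y μ f (Variant f T)
    Upward-Models⊆QVarᶠ T A (A∈Y , S , S∈Models , same-core) = A∈Y , λ Γ φ r →
      CoreValid-superalgebra A S same-core Γ φ (proj₂ (Models⊆QVarᶠ T (A ↾ S) S∈Models) Γ φ r)

-- Complete lattices

module _ {c ℓ₁ ℓ₂} (P : Poset c ℓ₁ ℓ₂) where
  open Poset P

  HasInfima : (s : Level) → Set (c ⊔ ℓ₂ ⊔ lsuc s)
  HasInfima s = (S : Pred Carrier s) → Σ[ m ∈ Carrier ]
    (∀ x → x ∈ S → m ≤ x) × (∀ z → (∀ x → x ∈ S → z ≤ x) → z ≤ m)

  HasSuprema : (s : Level) → Set (c ⊔ ℓ₂ ⊔ lsuc s)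
  HasSuprema s = (S : Pred Carrier s) → Σ[ j ∈ Carrier ]
    (∀ x → x ∈ S → x ≤ j) × (∀ z → (∀ x → x ∈ S → x ≤ z) → j ≤ z)

  -- The supremum is the infimum of the upper bounds. These may form a predicate of higher level
  -- than `S`, hence the assumption at every level.
  infima⇒complete : (∀ s → HasInfima s) → ∀ s → IsCompleteLattice s P
  infima⇒complete inf s = record
    { infimum  = inf s
    ; supremum = λ S → let j , lower , greatest = inf _ (λ z → ∀ x → x ∈ S → x ≤ z) in
        j , (λ x x∈S → greatest x λ z S≤z → S≤z x x∈S) , lower
    }

  suprema⇒complete : (∀ s → HasSuprema s) → ∀ s → IsCompleteLattice s P
  suprema⇒complete sup s = record
    { infimum  = λ S → let m , upper , least = sup _ (λ z → ∀ x → x ∈ S → z ≤ x) in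
        m , (λ x x∈S → least x λ z z≤S → z≤S x x∈S) , upper
    ; supremum = sup s
    }

-- As `F` reverses the order, a preimage of the infimum of the image of `S` is a supremum of `S`.
dual-infima⇒suprema : ∀ {c ℓ₁ ℓ₂ d ℓ₃ ℓ₄} (P : Poset c ℓ₁ ℓ₂) (Q : Poset d ℓ₃ ℓ₄)
  (F : Poset.Carrier P → Poset.Carrier Q) → IsDualIsomorphism P Q F →
  (∀ s → HasInfima Q s) → ∀ s → HasSuprema P s
dual-infima⇒suprema P Q F iso inf s S =
  j ,
  (λ x x∈S → cancel (Q.trans (Q.reflexive Fj≈m) (m≤ (F x) (x , x∈S , refl)))) ,
  (λ z S≤z → cancel (Q.trans (≤m (F z) λ { _ (x , x∈S , refl) → mono (S≤z x x∈S) })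
                             (Q.reflexive (Q.Eq.sym Fj≈m))))
  where
  module P = Poset P
  module Q = Poset Q
  open IsOrderIsomorphism iso
  image-inf = inf _ (λ q → Σ[ x ∈ P.Carrier ] x ∈ S × F x ≡ q)
  m = proj₁ image-inf
  m≤ = proj₁ (proj₂ image-inf)
  ≤m = proj₂ (proj₂ image-inf)
  j = proj₁ (surjective m)
  Fj≈m : F j Q.≈ m
  Fj≈m = proj₂ (surjective m) P.Eq.refl

-- Classical arguments and Maltsev's theorem

module _ (em : ∀ {ℓ : Level} → ExcludedMiddle ℓ) where

  private
    variable
      ℓ : Level
      P : Set ℓ

  by-contradiction : ¬ ¬ P → P
  by-contradiction = decidable-stable em

  -- Excluded middle makes every proposition equivalent to one in Set.
  Resize : Set ℓ → Set
  Resize P = True (em {P = P})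

  -- `ρ` sends an occurring variable to a position in the list of all occurring variables, and `π`
  -- reads that list.
  finite-renaming : X → (ts : List (Term L X)) →
    Σ[ ρ ∈ (X → ℕ) ] Σ[ π ∈ (ℕ → X) ]
      (∀ {t} → t ∈ˡ ts → (A : Algebra L) (v : X → Algebra.Carrier A) →
       eval A (v ∘ π) (t [ var ∘ ρ ]) ≡ eval A v t)
  finite-renaming {X = X} x₀ ts = ρ , nth x₀ xs , λ {t} t∈ts A v →
    ≡.trans (eval-[] A (v ∘ nth x₀ xs) (var ∘ ρ) t)
      (eval-local A t λ {x} x∈t →
        cong v (nth-ρ (∈-concatMap⁺ vars (Any.map (λ { refl → x∈t }) t∈ts))))
    where
    xs : List X
    xs = List.concatMap vars ts

    -- Variables that do not occur get an arbitrary number. Taking the decision as an argument lets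
    -- the case split in `nth-ρ` reduce `ρ`.
    ρ-aux : ∀ {x} → Dec (x ∈ˡ xs) → ℕ
    ρ-aux (yes x∈xs) = proj₁ (position x₀ x∈xs)
    ρ-aux (no _)     = zero

    ρ : X → ℕ
    ρ x = ρ-aux {x} em

    nth-ρ : ∀ {x} → x ∈ˡ xs → nth x₀ xs (ρ x) ≡ x
    nth-ρ {x} x∈xs with em {P = x ∈ˡ xs}
    ... | yes p  = proj₂ (position x₀ p)
    ... | no x∉xs = ⊥-elim (x∉xs x∈xs)

  countermodel : {K : Class L} {Θ : Pred (Eqn L) 0ℓ} {e : Eqn L} → ¬ Conseq L K Θ e →
    Σ[ A ∈ Algebra L ] A ∈ K × Σ[ v ∈ (ℕ → Algebra.Carrier A) ] HoldsAll A v Θ × ¬ Holds A v e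
  countermodel Θ⊭e = by-contradiction λ none → Θ⊭e λ A A∈K v h →
    by-contradiction λ ¬e → none (A , A∈K , v , h , ¬e)

  -- Maltsev's theorem: A embeds into a reduced product of members of K in which
  -- the positive diagram of A holds and its negative diagram is preserved.
  quasiequations⇒∈ : {K : Class L} → IsQuasivariety L K → (A : Algebra L) →
    (∀ (Θ : List (Eqn L)) e → Conseq L K ⟪ Θ ⟫ e →
     ∀ v → HoldsAll A v ⟪ Θ ⟫ → Holds A v e) →
    A ∈ K
  quasiequations⇒∈ {L} {K} K-quasi A valid = embedding-closed K-quasi embedding B∈K
    where
    open Algebra A using (Carrier; _≈_; op)

    True-eqn : Set
    True-eqn = Σ (Equation L Carrier) (Holds A id)

    Distinct : Set
    Distinct = Σ[ (a , b) ∈ Carrier × Carrier ] ¬ a ≈ b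

    disequation : Distinct → Equation L Carrier
    disequation ((a , b) , _) = var a ≈ᵉ var b

    sides : List True-eqn → List (Term L Carrier)
    sides []                     = []
    sides (((s ≈ᵉ t) , _) ∷ zs) = s ∷ t ∷ sides zs

    lhs∈ : ∀ {zs z} → z ∈ˡ zs → Equation.lhs (proj₁ z) ∈ˡ sides zs
    lhs∈ (here refl) = here refl
    lhs∈ (there m)   = there (there (lhs∈ m))

    rhs∈ : ∀ {zs z} → z ∈ˡ zs → Equation.rhs (proj₁ z) ∈ˡ sides zs
    rhs∈ (here refl) = there (here refl)
    rhs∈ (there m)   = there (there (rhs∈ m))

    finite-model : ∀ zs i → Σ[ B ∈ Algebra L ] B ∈ K × Σ[ v ∈ (Carrier → Algebra.Carrier B) ]
      (∀ z → z ∈ˡ zs → HoldsAll B v ⟪ proj₁ z ∷ [] ⟫) × ¬ HoldsAll B v ⟪ disequation i ∷ [] ⟫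
    finite-model zs i@((a , b) , a≉b) =
      let B , B∈K , w , h , ¬e = countermodel {e = var (ρ a) ≈ᵉ var (ρ b)} not-consequence in
      B , B∈K , w ∘ ρ ,
      (λ { (e , _) z∈zs _ (here refl) → Holds-[]⁻ B w (var ∘ ρ) e (h _ (∈-map⁺ _ z∈zs)) }) ,
      λ k → ¬e (k _ (here refl))
      where
      -- `var a` and `var b` are listed so that the renaming is faithful on the disequation too.
      renaming-data = finite-renaming a (var a ∷ var b ∷ sides zs)

      ρ : Carrier → ℕ
      ρ = proj₁ renaming-data

      π : ℕ → Carrier
      π = proj₁ (proj₂ renaming-data)

      ρ-π : ∀ {t} → t ∈ˡ var a ∷ var b ∷ sides zs → eval A π (t [ var ∘ ρ ]) ≡ eval A id t
      ρ-π t∈ = proj₂ (proj₂ renaming-data) t∈ A id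

      Θ : List (Eqn L)
      Θ = List.map (λ z → proj₁ z [ var ∘ ρ ]ᵉ) zs

      Θ-true : HoldsAll A π ⟪ Θ ⟫
      Θ-true e e∈Θ with ∈-map⁻ _ e∈Θ
      ... | (e′ , holds) , z∈zs , refl =
        subst₂ _≈_ (≡.sym (ρ-π (there (there (lhs∈ z∈zs)))))
                   (≡.sym (ρ-π (there (there (rhs∈ z∈zs))))) holds

      -- Otherwise `A` would satisfy the renamed quasi-equation, whose premises are true at `π`, and
      -- `a` would equal `b`.
      not-consequence : ¬ Conseq L K ⟪ Θ ⟫ (var (ρ a) ≈ᵉ var (ρ b))
      not-consequence Θ⊨e = a≉b
        (subst₂ _≈_ (ρ-π (here refl)) (ρ-π (there (here refl)))
          (valid Θ (var (ρ a) ≈ᵉ var (ρ b)) Θ⊨e π Θ-true))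

    ambient : Σ[ B ∈ Algebra L ] B ∈ K × Σ[ v ∈ (Carrier → Algebra.Carrier B) ]
      (∀ z → HoldsAll B v ⟪ proj₁ z ∷ [] ⟫) × (∀ i → ¬ HoldsAll B v ⟪ disequation i ∷ [] ⟫)
    ambient = simultaneous-model K K-quasi (λ z → proj₁ z ∷ []) (λ i → disequation i ∷ [])
                finite-model

    B : Algebra L
    B = proj₁ ambient

    B∈K : B ∈ K
    B∈K = proj₁ (proj₂ ambient)

    h : Carrier → Algebra.Carrier B
    h = proj₁ (proj₂ (proj₂ ambient))

    preserved : ∀ e → Holds A id e → Holds B h e
    preserved e holds = proj₁ (proj₂ (proj₂ (proj₂ ambient))) (e , holds) e (here refl)

    eval*-map-var : ∀ {n} (xs : Vec Carrier n) → eval* B h (Vec.map var xs) ≡ Vec.map h xs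
    eval*-map-var []       = refl
    eval*-map-var (x ∷ xs) = cong (_ ∷_) (eval*-map-var xs)

    embedding : Embedding A B
    embedding = record
      { to        = h
      ; to-cong   = λ {a} {b} → preserved (var a ≈ᵉ var b)
      ; injective = λ {a} {b} ha≈hb → by-contradiction λ a≉b →
          proj₂ (proj₂ (proj₂ (proj₂ ambient))) ((a , b) , a≉b) λ { _ (here refl) → ha≈hb }
      ; homo      = λ o xs →
          subst (λ ys → Algebra._≈_ B (h (op o xs)) (Algebra.op B o ys)) (eval*-map-var xs)
            (preserved (var (op o xs) ≈ᵉ app o (Vec.map var xs))
              (Algebra.reflexive A (cong (op o) (≡.sym (eval*-vars A xs)))))
      }

  -- By Maltsev's theorem the quasi-equations of `Y` suffice. An assignment is a substitution, and
  -- `D`, being closed, contains the instance of the conclusion with those of the premises.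
  TermModel∈ : {Y : Class L} → IsQuasivariety L Y → (D : Pred (Eqn L) 0ℓ)
    (closed : ∀ e → Conseq L Y D e → e ∈ D) → TermModel D closed ∈ Y
  TermModel∈ Y-quasi D closed = quasiequations⇒∈ Y-quasi (TermModel D closed)
    λ Θ e Θ⊨e σ h → TermModel-Holds⁺ D closed σ e (closed (e [ σ ]ᵉ) λ A A∈Y v hD →
      Holds-[]⁺ A v σ e (Θ⊨e A A∈Y _ λ e′ e′∈Θ →
        Holds-[]⁻ A v σ e′ (hD _ (TermModel-Holds⁻ D closed σ e′ (h e′ e′∈Θ)))))

  -- The logic of a quasivariety

  module _ (μ : Eqns₁ L) where

    ¬Valid⇒countermodel : {K : Class L} {Γ : Pred (Form L) 0ℓ} {φ : Form L} → ¬ LogicOf μ K Γ φ →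
      Σ[ A ∈ Algebra L ] A ∈ K × Σ[ v ∈ (ℕ → Algebra.Carrier A) ]
        AllDesignated μ A v Γ × ¬ Designated μ A (eval A v φ)
    ¬Valid⇒countermodel Γ⊬φ = by-contradiction λ none → Γ⊬φ λ A A∈K v prem →
      by-contradiction λ ¬φ → none (A , A∈K , v , prem , ¬φ)

    -- If every finite part of `Γ` had a countermodel to `φ`, a reduced product of these would
    -- satisfy all of `Γ` and still refute `φ`.
    LogicOf-finitary : {K : Class L} → IsQuasivariety L K → ∀ Γ φ → LogicOf μ K Γ φ →
      Σ[ V ∈ List (Form L) ] Allˡ.All (_∈ Γ) V × LogicOf μ K ⟪ V ⟫ φ
    LogicOf-finitary {K} K-quasi Γ φ Γ⊨φ = by-contradiction λ none →
      let A , A∈K , v , good , bad = simultaneous-model K K-quasi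
            {E = ⊤} (λ ((ψ , _) : Σ (Form L) Γ) → instances ψ) (λ _ → instances φ)
            λ zs _ →
              let A , A∈K , v , prem , ¬φ = ¬Valid⇒countermodel {K = K} {φ = φ} λ r →
                    none (List.map proj₁ zs , Allˡ.map⁺ (Allˡ.universal proj₂ zs) , r)
              in A , A∈K , v ,
                 (λ (ψ , _) z∈zs → Designated⇒μ μ A v ψ (prem ψ (∈-map⁺ proj₁ z∈zs))) ,
                 ¬φ ∘ μ⇒Designated μ A v φ
      in bad tt (Designated⇒μ μ A v φ
           (Γ⊨φ A A∈K v λ ψ ψ∈Γ → μ⇒Designated μ A v ψ (good (ψ , ψ∈Γ))))
      where
      instances : Form L → List (Eqn L)
      instances ψ = List.map (_[ (λ _ → ψ) ]ᵉ) μ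

    LogicOf-isLogic : {K : Class L} → IsQuasivariety L K → IsLogic L (LogicOf μ K)
    LogicOf-isLogic K-quasi = record
      { isConsequence = record
        { reflexive = λ Γ φ φ∈Γ A _ v prem → prem φ φ∈Γ
        ; cut       = λ Γ V φ Γ⊨V V⊨φ A A∈K v prem →
                        V⊨φ A A∈K v λ ψ ψ∈V → Γ⊨V ψ ψ∈V A A∈K v prem
        ; finitary  = LogicOf-finitary K-quasi
        }
      ; structural = λ σ Γ φ Γ⊨φ A A∈K v prem → Designated-[]⁺ μ A v σ φ
          (Γ⊨φ A A∈K _ λ ψ ψ∈Γ → Designated-[]⁻ μ A v σ ψ (prem _ (ψ , ψ∈Γ , refl)))
      }

  -- Extensions of an algebraizable logic and subquasivarieties

  module _ {_⊢_ : Rel⊢ L} {Y : Class L} {μ : Eqns₁ L} {Δ : Forms₂ L}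
           (Y-quasi : IsQuasivariety L Y) (alg : Algebraizes L _⊢_ Y μ Δ) where
    open Algebraizes alg

    LogicOf-isExtension : {K : Class L} → IsSubquasivariety L Y K → IsExtension L _⊢_ (LogicOf μ K)
    LogicOf-isExtension (K-quasi , K⊆Y) = LogicOf-isLogic μ K-quasi , λ Γ φ Γ⊢φ A A∈K v prem →
      μ⇒Designated μ A v φ λ e e∈ →
        Equivalence.to (μ-equivalence Γ φ) Γ⊢φ e e∈ A (K⊆Y A A∈K) v (AllDesignated⇒μ μ A v Γ prem)

    -- Each quasi-equation of `K` is translated by `Δ` into rules of the logic of `K`. These are
    -- valid in `A`, and `μΔ-inverse` translates them back, so Maltsev's theorem applies.
    Models-LogicOf⊆ : {K : Class L} → IsSubquasivariety L Y K → Models μ Y (LogicOf μ K) ⊆′ K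
    Models-LogicOf⊆ {K} (K-quasi , K⊆Y) A (A∈Y , valid) =
      quasiequations⇒∈ K-quasi A λ Θ e Θ⊨e v hΘ →
        proj₂ (μΔ-inverse e) A A∈Y v (AllDesignated⇒μ μ A v _ λ δ δ∈ →
          valid (Δ ⟦ ⟪ Θ ⟫ ⟧₂) δ
            -- This argument verifies the translated rule in `K`; the last one verifies its premises
            -- in `A`.
            (λ B B∈K w prem → μ⇒Designated μ B w δ λ e′ e′∈ →
              proj₁ (μΔ-inverse e) e′ (δ , δ∈ , e′∈) B (K⊆Y B B∈K) w λ { _ refl →
                Θ⊨e B B∈K w λ e″ e″∈ → proj₂ (μΔ-inverse e″) B (K⊆Y B B∈K) w
                  (AllDesignated⇒μ μ B w _ λ χ χ∈ → prem χ (e″ , e″∈ , χ∈)) })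
            v
            λ χ (e′ , e′∈ , χ∈) → μ⇒Designated μ A v χ λ e″ e″∈ →
              proj₁ (μΔ-inverse e′) e″ (χ , χ∈ , e″∈) A A∈Y v λ { _ refl → hΘ e′ e′∈ })

    module _ {T : Rel⊢ L} (T-ext : IsExtension L _⊢_ T) where
      private
        extends : ∀ Γ φ → Γ ⊢ φ → T Γ φ
        extends = proj₂ T-ext
      open IsLogic (proj₁ T-ext)
      open IsConsequence isConsequence

      -- The Lindenbaum–Tarski algebra of the theory of T axiomatized by Γ lies in
      -- Models μ Y T, and its designated elements are the theorems of that theory.
      LogicOf-Models⊆ : ∀ Γ φ → LogicOf μ (Models μ Y T) Γ φ → T Γ φ
      LogicOf-Models⊆ Γ φ Γ⊨φ =
        Designated⇒T φ (subst (Designated μ M) (≡.trans (eval-TermModel D closed var φ) ([]-var φ))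
          (Γ⊨φ M M∈ var λ ψ ψ∈Γ →
            subst (Designated μ M) (≡.sym (≡.trans (eval-TermModel D closed var ψ) ([]-var ψ)))
              (T⇒Designated ψ (reflexive Γ ψ ψ∈Γ))))
        where
        -- The Leibniz congruence of the theory axiomatized by `Γ`, resized because derivability is
        -- `Set₁`-valued.
        D : Pred (Eqn L) 0ℓ
        D e = Resize (Derives T Γ (Δ ⟨ e ⟩₂))

        closed : ∀ e → Conseq L Y D e → e ∈ D
        -- `Δ-equivalence` turns the consequence over `Y` into derivations in `⊢`, hence in `T`,
        -- from formulas that `Γ` already derives.
        closed e D⊨e = fromWitness λ δ δ∈ →
          cut Γ (Δ ⟦ D ⟧₂) δ (λ χ (e′ , e′∈D , χ∈) → toWitness e′∈D χ χ∈)
            (extends _ _ (Equivalence.to (Δ-equivalence D e) D⊨e δ δ∈))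

        M : Algebra L
        M = TermModel D closed

        Designated⇒T : ∀ s → Designated μ M s → T Γ s
        Designated⇒T s d = cut Γ (Δ ⟦ μ ⟨ s ⟩ ⟧₂) s derive (extends _ _ (proj₂ (Δμ-inverse s)))
          where
          derive : Derives T Γ (Δ ⟦ μ ⟨ s ⟩ ⟧₂)
          derive δ (e , e∈ , δ∈) with ∈-map⁻ _ e∈
          ... | m , m∈μ , refl =
            toWitness (TermModel-Holds⁻ D closed (λ _ → s) m (d m m∈μ)) δ δ∈

        T⇒Designated : ∀ s → T Γ s → Designated μ M s
        T⇒Designated s Γ⊢s m m∈μ = TermModel-Holds⁺ D closed (λ _ → s) m (fromWitness λ δ δ∈ →
          cut Γ ｛ s ｝ δ (λ { _ refl → Γ⊢s })
            (extends _ _ (proj₁ (Δμ-inverse s) δ (_ , ∈-map⁺ _ m∈μ , δ∈))))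

        M∈ : M ∈ Models μ Y T
        -- Assignments into `M` are substitutions, so structurality of `T` and cut give the instance
        -- of the rule under `σ`.
        M∈ = TermModel∈ Y-quasi D closed , λ Γ′ φ′ r σ prem →
          subst (Designated μ M) (≡.sym (eval-TermModel D closed σ φ′))
            (T⇒Designated (φ′ [ σ ]) (cut Γ (Image (_[ σ ]) Γ′) (φ′ [ σ ])
              (λ { _ (ψ , ψ∈ , refl) → Designated⇒T (ψ [ σ ])
                     (subst (Designated μ M) (eval-TermModel D closed σ ψ) (prem ψ ψ∈)) })
              (structural σ Γ′ φ′ r)))

  -- Core superalgebras and intersections

  module _ {Y : Class L} (Y-quasi : IsQuasivariety L Y) (f : Unary L) (idem : IdempotentIn L Y f)
           where

    -- A is in the class of core superalgebras of K as soon as the subalgebra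
    -- generated by its core is in K, so intersections may be taken below ↑.
    FQuasivarieties-infima : ∀ s → HasInfima (FQuasivarieties L Y f) s
    FQuasivarieties-infima s S =
      (Upward L Y f K , K , (K-quasi , λ _ → proj₁) , (λ _ → id) , (λ _ → id)) ,
      (λ V@(_ , K′ , _ , _ , ↑K′⊆V) V∈S A A∈ →
        ↑K′⊆V A (Upward-mono f Y K K′ (λ B (_ , B∈) → toWitness B∈ V V∈S) A A∈)) ,
      greatest
      where
      K : Class L
      -- The conjunct `A ∈ Y` bounds the empty intersection; resizing absorbs the arbitrary level of
      -- `S`.
      K A = A ∈ Y × Resize (∀ V → V ∈ S → A ∈ proj₁ (proj₂ V))

      module Y = IsQuasivariety Y-quasi
      module Member (V : Poset.Carrier (FQuasivarieties L Y f)) =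
        IsQuasivariety (proj₁ (proj₁ (proj₂ (proj₂ V))))

      K-quasi : IsQuasivariety L K
      K-quasi = record
        { iso-closed     = λ A≅B (A∈Y , A∈) → Y.iso-closed A≅B A∈Y ,
            fromWitness λ V V∈S → Member.iso-closed V A≅B (toWitness A∈ V V∈S)
        ; sub-closed     = λ T (A∈Y , A∈) → Y.sub-closed T A∈Y ,
            fromWitness λ V V∈S → Member.sub-closed V T (toWitness A∈ V V∈S)
        ; reduced-closed = λ A F A∈ → Y.reduced-closed A F (proj₁ ∘ A∈) ,
            fromWitness λ V V∈S →
              Member.reduced-closed V A F (λ i → toWitness (proj₂ (A∈ i)) V V∈S)
        }

      greatest : ∀ U → (∀ V → V ∈ S → proj₁ U ⊆′ proj₁ V) → proj₁ U ⊆′ Upward L Y f K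
      greatest (_ , _ , _ , U⊆↑ , _) U≤ A A∈U =
        A∈Y , G , (Y.sub-closed G A∈Y , fromWitness G∈) ,
        Core⊆⇒CoreSubalgebra f A G (core⊆coreGenerated f A c₀)
        where
        A∈Y : A ∈ Y
        A∈Y = proj₁ (U⊆↑ A A∈U)

        c₀ : ∃ (Core A f)
        c₀ = core-inhabited f idem A∈Y

        G : Subuniverse A
        G = coreGenerated f A c₀

        G∈ : ∀ V → V ∈ S → (A ↾ G) ∈ proj₁ (proj₂ V)
        -- The subalgebra generated by the core lies inside whichever subalgebra `T` witnesses that
        -- `A` is above a member of `K′`.
        G∈ V@(_ , _ , (K′-quasi , _) , V⊆↑ , _) V∈S with V⊆↑ A (U≤ V V∈S A A∈U)
        ... | _ , T , T∈K′ , core⊆T , _ =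
          embedding-closed K′-quasi
            (subuniverse-⊆⇒embedding A G T (coreGenerated-least f A c₀ T (proj₁ ∘ core⊆T))) T∈K′

    module _ (μ : Eqns₁ L) {T : Rel⊢ L} (T-logic : IsLogic L T) where
      open IsLogic T-logic
      open IsConsequence isConsequence

      -- Elements of the subalgebra generated by the core are values of terms at
      -- core elements, so a rule evaluated there is a substitution instance of it
      -- evaluated in the core. Only finitely many core elements occur, hence the
      -- instance can be written with variables from ℕ.
      coreGenerated∈Models : ∀ {A} → A ∈ QVarᶠ L Y μ f (Variant f T) → ∀ c₀ →
                             (A ↾ coreGenerated f A c₀) ∈ Models μ Y T
      coreGenerated∈Models {A} (A∈Y , core-valid) c₀ =
        IsQuasivariety.sub-closed Y-quasi G A∈Y , valid
        where
        G : Subuniverse A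
        G = coreGenerated f A c₀

        CoreElt : Set
        CoreElt = ∃ (Core A f)

        valid : ∀ Γ φ → T Γ φ → Valid μ (A ↾ G) Γ φ
        valid Γ φ r v prem = Designated-to⁻ μ (inclusion A G)
          (Designated-resp μ A (value φ (here refl))
            (μ⇒Designated μ A w (φ [ σ ])
              (core-valid _ _ instance-derivable w (λ n → proj₂ (π n))
                (AllDesignated⇒μ μ A w _ premises))))
          where
          V : List (Form L)
          V = proj₁ (finitary Γ φ r)

          τ : ℕ → Term L CoreElt
          τ p = proj₁ (proj₂ (v p))

          -- `c₀` is the default value of `π`, so `w` takes core values even at variables that name
          -- no occurring core element.
          finite = finite-renaming c₀ (List.map (_[ τ ]) (φ ∷ V))

          ρ : CoreElt → ℕ
          ρ = proj₁ finite

          π : ℕ → CoreElt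
          π = proj₁ (proj₂ finite)

          σ : ℕ → Form L
          σ p = τ p [ var ∘ ρ ]

          w : ℕ → Algebra.Carrier A
          w = proj₁ ∘ π

          value : ∀ ψ → ψ ∈ˡ φ ∷ V → Algebra._≈_ A (eval A w (ψ [ σ ])) (proj₁ (eval (A ↾ G) v ψ))
          value ψ ψ∈ = begin
            eval A w (ψ [ σ ])                  ≡⟨ cong (eval A w) ([]-∘ τ (var ∘ ρ) ψ) ⟨
            eval A w (ψ [ τ ] [ var ∘ ρ ])      ≡⟨ proj₂ (proj₂ finite) (∈-map⁺ _ ψ∈) A proj₁ ⟩
            eval A proj₁ (ψ [ τ ])              ≡⟨ eval-[] A proj₁ τ ψ ⟩
            eval A (λ p → eval A proj₁ (τ p)) ψ ≈⟨ eval-cong A (λ p → proj₂ (proj₂ (v p))) ψ ⟩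
            eval A (proj₁ ∘ v) ψ                ≈⟨ Embedding.to-eval (inclusion A G) v ψ ⟨
            proj₁ (eval (A ↾ G) v ψ)            ∎
            where open ≈-Reasoning (Algebra.setoid A)

          instance-derivable : Variant f T (Image (_[ σ ]) ⟪ V ⟫) (φ [ σ ])
          -- Structurality is used first for `σ` and then for the substitution of f(q) for q that
          -- defines the variant.
          instance-derivable = structural _ _ _ (structural σ _ _ (proj₂ (proj₂ (finitary Γ φ r))))

          premises : AllDesignated μ A w (Image (_[ σ ]) ⟪ V ⟫)
          premises _ (ψ , ψ∈V , refl) =
            Designated-resp μ A (Algebra.sym A (value ψ (there ψ∈V)))
              (Designated-to⁺ μ (inclusion A G)
                (prem ψ (Allˡ.lookup (proj₁ (proj₂ (finitary Γ φ r))) ψ∈V)))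

      QVarᶠ⊆Upward-Models : QVarᶠ L Y μ f (Variant f T) ⊆′ Upward L Y f (Models μ Y T)
      QVarᶠ⊆Upward-Models A A∈@(A∈Y , _) =
        A∈Y , coreGenerated f A c₀ , coreGenerated∈Models A∈ c₀ ,
        Core⊆⇒CoreSubalgebra f A (coreGenerated f A c₀) (core⊆coreGenerated f A c₀)
        where
        c₀ : ∃ (Core A f)
        c₀ = core-inhabited f idem A∈Y

    -- The dual isomorphism

    module _ {_⊢_ : Rel⊢ L} {μ : Eqns₁ L} {Δ : Forms₂ L} (alg : Algebraizes L _⊢_ Y μ Δ) where

      QVarᶠ-isFQuasivariety : ∀ R → IsFLogic L _⊢_ f R → IsFQuasivariety L Y f (QVarᶠ L Y μ f R)
      QVarᶠ-isFQuasivariety R (T , (T-logic , _) , R⊆Tᶠ , Tᶠ⊆R) =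
        Models μ Y T ,
        (Models-isQuasivariety μ Y-quasi (IsLogic.isConsequence T-logic) , λ _ → proj₁) ,
        (λ A A∈ → QVarᶠ⊆Upward-Models μ T-logic A (QVarᶠ-antitone f Y μ Tᶠ⊆R A A∈)) ,
        (λ A A∈ → QVarᶠ-antitone f Y μ R⊆Tᶠ A (Upward-Models⊆QVarᶠ f Y μ T A A∈))

      -- By completeness of `T′` for its models, the substituted rule need only be checked in each
      -- model of `T′`. Such a model is in `QVarᶠ` of `R`, and the rule at the core assignment
      -- f(v(p)) is the substituted rule at `v`.
      QVarᶠ-reflects-⊆ : ∀ {R R′} → IsFLogic L _⊢_ f R′ →
                         QVarᶠ L Y μ f R′ ⊆′ QVarᶠ L Y μ f R → uncurry R ⊆′ uncurry R′
      QVarᶠ-reflects-⊆ (T′ , T′-ext , R′⊆ , ⊆R′) Q⊆Q (Γ , φ) r = ⊆R′ (Γ , φ)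
        (LogicOf-Models⊆ Y-quasi alg T′-ext _ _ λ A A∈@(A∈Y , _) v prem →
          Designated-[]⁺ μ A v _ φ (μ⇒Designated μ A _ φ
            (proj₂ (Q⊆Q A (QVarᶠ-antitone f Y μ R′⊆ A (Models⊆QVarᶠ f Y μ T′ A A∈))) Γ φ r
              _ (f·var∈Core f idem A∈Y v)
              (AllDesignated⇒μ μ A _ Γ λ ψ ψ∈Γ →
                Designated-[]⁻ μ A v _ ψ (prem _ (ψ , ψ∈Γ , refl))))))

      -- Gives surjectivity: the class is that of the core superalgebras of the models of
      -- `LogicOf μ K`, and these models are the members of `K`.
      QVarᶠ-LogicOf : (K : Class L) → IsSubquasivariety L Y K →
                      QVarᶠ L Y μ f (Variant f (LogicOf μ K)) ≐′ Upward L Y f K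
      QVarᶠ-LogicOf K K-sub@(K-quasi , K⊆Y) =
        (λ A A∈ → Upward-mono f Y (Models μ Y (LogicOf μ K)) K (Models-LogicOf⊆ Y-quasi alg K-sub) A
          (QVarᶠ⊆Upward-Models μ (LogicOf-isLogic μ K-quasi) A A∈)) ,
        (λ A A∈ → Upward-Models⊆QVarᶠ f Y μ (LogicOf μ K) A
          (Upward-mono f Y K (Models μ Y (LogicOf μ K)) (λ B B∈K → K⊆Y B B∈K , λ Γ φ r → r B B∈K) A A∈))

      QVarᶠ-isDualIsomorphism : IsDualIsomorphism (FLogics L _⊢_ f) (FQuasivarieties L Y f)
        (λ (R , R∈Λᶠ) → QVarᶠ L Y μ f R , QVarᶠ-isFQuasivariety R R∈Λᶠ)
      QVarᶠ-isDualIsomorphism = record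
        { isOrderMonomorphism = record
          { isOrderHomomorphism = record
            { cong = λ (R⊆R′ , R′⊆R) → QVarᶠ-antitone f Y μ R′⊆R , QVarᶠ-antitone f Y μ R⊆R′
            ; mono = QVarᶠ-antitone f Y μ
            }
          ; injective = λ {(_ , R∈)} {(_ , R′∈)} (Q⊆Q′ , Q′⊆Q) →
              QVarᶠ-reflects-⊆ R′∈ Q′⊆Q , QVarᶠ-reflects-⊆ R∈ Q⊆Q′
          ; cancel    = λ {_} {(_ , R′∈)} → QVarᶠ-reflects-⊆ R′∈
          }
        ; surjective = λ (V , K , K-sub , V⊆↑K , ↑K⊆V) →
            (Variant f (LogicOf μ K) , LogicOf μ K , LogicOf-isExtension Y-quasi alg K-sub ,
              (λ _ → id) , (λ _ → id)) ,
            λ (R⊆ , ⊆R) →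
              (λ A A∈ → ↑K⊆V A (proj₁ (QVarᶠ-LogicOf K K-sub) A (QVarᶠ-antitone f Y μ ⊆R A A∈))) ,
              (λ A A∈ → QVarᶠ-antitone f Y μ R⊆ A (proj₂ (QVarᶠ-LogicOf K K-sub) A (V⊆↑K A A∈)))
        }

corollary3p27 : (∀ {ℓ : Level} → ExcludedMiddle ℓ) →
    (L : Signature) (_⊢_ : Rel⊢ L) (Y : Class L) (μ : Eqns₁ L) (Δ : Forms₂ L) (f : Unary L) →
    IsLogic L _⊢_ →
    IsQuasivariety L Y →
    Algebraizes L _⊢_ Y μ Δ →
    IsSelector L _⊢_ f →
    IdempotentIn L Y f →
    (s : Level) →
    IsCompleteLattice s (FLogics L _⊢_ f) ×
    IsCompleteLattice s (FQuasivarieties L Y f) ×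
    (Σ[ closed ∈ (∀ R → IsFLogic L _⊢_ f R → IsFQuasivariety L Y f (QVarᶠ L Y μ f R)) ]
    IsDualIsomorphism (FLogics L _⊢_ f) (FQuasivarieties L Y f)
    (λ (R , R∈Λᶠ) → QVarᶠ L Y μ f R , closed R R∈Λᶠ))
corollary3p27 em L _⊢_ Y μ Δ f _ Y-quasi alg _ idem s =
  suprema⇒complete Λᶠ (dual-infima⇒suprema Λᶠ Ξᶠ _ dual-iso infima) s ,
  infima⇒complete Ξᶠ infima s ,
  QVarᶠ-isFQuasivariety em Y-quasi f idem alg ,
  dual-iso
  where
  Λᶠ = FLogics L _⊢_ f
  Ξᶠ = FQuasivarieties L Y f
  infima = FQuasivarieties-infima em Y-quasi f idem
  dual-iso = QVarᶠ-isDualIsomorphism em Y-quasi f idem alg
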